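{- For every nonnegative integer $n$, $$pod(n)=\sum_{j=0}^{\infty}A(j)\,\overline{p}(n-j).$$
   Context: $pod(n)$ denotes the number of partitions of $n$ in which odd parts are distinct and even parts may be repeated, with $pod(0)=1$. An overpartition of $n$ is a non-increasing sequence of positive integers with sum $n$ in which the first occurrence of each number may be overlined; $\overline{p}(n)$ is the number of overpartitions of $n$, with $\overline{p}(0)=1$ and $\overline{p}(m)=0$ for $m<0$. Let $a_e(n)$ (respectively $a_o(n)$) be the number of partitions of $n$ into an even (respectively odd) number of parts in which the even parts can appear in two colours, and let $A(n)=a_e(n)-a_o(n)$, with $A(0)=1$. The generating function is $\sum_{n\ge0}A(n)q^n=\prod_{k\ge1}\frac{1}{(1+q^k)(1+q^{2k})}$. -}

module Defs where

open import Data.Bool using (Bool; true; false)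
import Data.Bool.Properties as Bool
open import Data.Fin using (Fin; zero)
import Data.Fin as Fin
import Data.Fin.Properties as Fin
open import Data.Integer using (ℤ; +_; -[1+_]; 0ℤ; _-_)
import Data.Integer as ℤ
open import Data.List using (List; []; _∷_; map; length; filter; upTo;
  allFin; cartesianProduct; cartesianProductWith)
open import Data.List.Relation.Unary.All using (All; all?)
open import Data.List.Relation.Unary.AllPairs using (AllPairs; allPairs?)
open import Data.List.Relation.Unary.Linked using (Linked; linked?)
open import Data.List.Relation.Unary.Unique.Propositional using (Unique)
open import Data.Nat using (ℕ; zero; suc; _≤_; _<_; _≥_; _≟_; _<?_; _≥?_)
open import Data.Nat.Divisibility using (_∣_; _∣?_)
open import Data.List.Relation.Unary.Unique.DecPropositional _≟_ using (unique?)
open import Data.Nat.ListAction using (sum)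
open import Data.Product using (∃; _×_; _,_; proj₁)
open import Relation.Binary.PropositionalEquality using (_≡_; refl)
open import Relation.Nullary using (¬_; ¬?; _×-dec_; _→-dec_)
open import Relation.Unary using (Decidable)

Even Odd : ℕ → Set
Even n = 2 ∣ n
Odd  n = ¬ Even n

even? : Decidable Even
even? n = 2 ∣? n

odd? : Decidable Odd
odd? n = ¬? (even? n)

IsPartition : ℕ → List ℕ → Set
IsPartition n ps = All (0 <_) ps × Linked _≥_ ps × sum ps ≡ n

isPartition? : ∀ n → Decidable (IsPartition n)
isPartition? n ps = all? (0 <?_) ps ×-dec linked? _≥?_ ps ×-dec sum ps ≟ n

IsPodPartition : ℕ → List ℕ → Set
IsPodPartition n ps = IsPartition n ps × Unique (filter odd? ps)

isPodPartition? : ∀ n → Decidable (IsPodPartition n)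
isPodPartition? n ps = isPartition? n ps ×-dec unique? (filter odd? ps)

-- The flag of a part is `true` when the part is overlined; a part that has an
-- equal part before it is not a first occurrence, so it must be plain.
IsOverpartition : ℕ → List (ℕ × Bool) → Set
IsOverpartition n ps =
  IsPartition n (map proj₁ ps) ×
  AllPairs (λ (s , _) (t , overlined) → s ≡ t → overlined ≡ false) ps

isOverpartition? : ∀ n → Decidable (IsOverpartition n)
isOverpartition? n ps =
  isPartition? n (map proj₁ ps) ×-dec
  allPairs? (λ (s , _) (t , o) → (s ≟ t) →-dec (o Bool.≟ false)) ps

-- Odd parts have only colour 0.  A partition is a multiset of coloured parts;
-- listing equal parts by increasing colour gives each multiset exactly one
-- list.
IsTwoColouredPartition : ℕ → List (ℕ × Fin 2) → Set
IsTwoColouredPartition n ps =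
  IsPartition n (map proj₁ ps) ×
  All (λ (s , c) → Odd s → c ≡ zero) ps ×
  Linked (λ (s , c) (t , d) → s ≡ t → c Fin.≤ d) ps

isTwoColouredPartition? : ∀ n → Decidable (IsTwoColouredPartition n)
isTwoColouredPartition? n ps =
  isPartition? n (map proj₁ ps) ×-dec
  all? (λ (s , c) → odd? s →-dec (c Fin.≟ zero)) ps ×-dec
  linked? (λ (s , c) (t , d) → (s ≟ t) →-dec (c Fin.≤? d)) ps

-- All lists of length at most k with entries from the given list.
listsUpTo : {A : Set} → List A → ℕ → List (List A)
listsUpTo as zero    = [] ∷ []
listsUpTo as (suc k) = [] ∷ cartesianProductWith _∷_ as (listsUpTo as k)

parts : ℕ → List ℕ
parts n = map suc (upTo n)

-- Positive integers with sum n are at most n in number and in size, so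
-- searching listsUpTo (parts n) n, or its analogue for decorated parts, misses
-- nothing; these enumerations have no repetitions, so filtering them counts.

pod : ℕ → ℕ
pod n = length (filter (isPodPartition? n) (listsUpTo (parts n) n))

overpartitions : ℕ → List (List (ℕ × Bool))
overpartitions n = filter (isOverpartition? n)
  (listsUpTo (cartesianProduct (parts n) (false ∷ true ∷ [])) n)

p̄ : ℤ → ℕ
p̄ (+ n)    = length (overpartitions n)
p̄ -[1+ _ ] = 0

twoColouredPartitions : ℕ → List (List (ℕ × Fin 2))
twoColouredPartitions n = filter (isTwoColouredPartition? n)
  (listsUpTo (cartesianProduct (parts n) (allFin 2)) n)

aₑ aₒ : ℕ → ℕ
aₑ n = length (filter (λ ps → even? (length ps)) (twoColouredPartitions n))
aₒ n = length (filter (λ ps → odd?  (length ps)) (twoColouredPartitions n))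

A : ℕ → ℤ
A n = + aₑ n - + aₒ n

_ : pod 0 ≡ 1
_ = refl

_ : p̄ (+ 0) ≡ 1
_ = refl

_ : A 0 ≡ + 1
_ = refl

partialSum : (ℕ → ℤ) → ℕ → ℤ
partialSum f zero    = 0ℤ
partialSum f (suc n) = partialSum f n ℤ.+ f n

-- The infinite series f 0 + f 1 + f 2 + … converges to s: a series of integers
-- converges exactly when its partial sums are eventually constant.
infix 4 _SumsTo_
_SumsTo_ : (ℕ → ℤ) → ℤ → Set
f SumsTo s = ∃ λ N → ∀ n → N ≤ n → partialSum f n ≡ s

-- Restrict all parts to be at most m.  Adding the part k to the alphabet multiplies
-- the generating function of A by 1 / (1 + qᵏ), squared if k is even, that of p̄ by
-- (1 + qᵏ) / (1 - qᵏ), and that of pod by 1 + qᵏ or 1 / (1 - qᵏ) as k is odd or even.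
-- Hence H = ∏ (1 - qᵏ) (k odd) · ∏ (1 - q²ᵏ) (k even) inverts the product of the first
-- two, while H · ∏ (1 - qᵏ) (k even) · pod = ∏ (1 - q²ᵏ) (all k).  The last product
-- agrees with ∏ (1 - qᵏ) (k even, k ≤ m) up to qᵐ, so after cancelling, both sides of
-- the theorem agree up to qᵐ.

module Submission where

open import Defs
open import Data.Nat using (ℕ)
open import Data.Integer using (+_; _-_; _*_)

open import Data.Nat using (zero; suc; _≤_; _<_; z≤n; s≤s)
import Data.Nat as ℕ
import Data.Nat.Properties as ℕₚ
open import Data.Nat.Divisibility using (_∣_; ∣m∣n⇒∣m+n; ∣m+n∣m⇒∣n; ∣-refl; m∣m*n; ∣⇒≤; _∣0)
open import Data.Nat.ListAction using (sum)
open import Data.Integer using (ℤ; -[1+_]; 0ℤ; 1ℤ; -1ℤ; -_; _+_)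
import Data.Integer as ℤ
import Data.Integer.Properties as ℤₚ
open import Data.Integer.Tactic.RingSolver using (solve-∀)
open import Algebra.Properties.AbelianGroup ℤₚ.+-0-abelianGroup using (∙-cancelʳ)
open import Data.Bool using (Bool; true; false)
import Data.Bool.Properties as Bool
open import Data.Fin using (Fin; zero; suc)
import Data.Fin as Fin
open import Data.List using (List; []; _∷_; _++_; length; map; filter; cartesianProductWith)
open import Data.List.Properties using (filter-accept; filter-reject; map-id)
open import Data.List.Membership.Propositional using (_∈_)
open import Data.List.Membership.Propositional.Properties
  using (∈-++⁺ˡ; ∈-++⁺ʳ; ∈-++⁻; ∈-map⁺; ∈-map⁻; ∈-filter⁺; ∈-filter⁻; ∈-upTo⁺; ∈-allFin;
    ∈-cartesianProduct⁺; ∈-cartesianProductWith⁺; ∈-cartesianProductWith⁻)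
open import Data.List.Membership.Propositional.Properties.WithK using (unique∧set⇒bag)
open import Data.List.Relation.Binary.BagAndSetEquality using (∼bag⇒↭)
open import Data.List.Relation.Binary.Permutation.Propositional as ↭ using (_↭_)
open import Data.List.Relation.Unary.All as All using (All; []; _∷_)
import Data.List.Relation.Unary.All.Properties as All
open import Data.List.Relation.Unary.AllPairs as AllPairs using (AllPairs; []; _∷_; allPairs?)
import Data.List.Relation.Unary.AllPairs.Properties as AllPairs
open import Data.List.Relation.Unary.Any using (here; there)
import Data.List.Relation.Unary.Linked as Linked
import Data.List.Relation.Unary.Linked.Properties as Linked
open import Data.List.Relation.Unary.Unique.Propositional using (Unique)
import Data.List.Relation.Unary.Unique.Propositional.Properties as Unique
open import Data.Product using (∃; _×_; _,_; proj₁; proj₂)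
open import Data.Sum using (_⊎_; inj₁; inj₂)
open import Function using (_∘_; flip; id; _⇔_; mk⇔; Equivalence)
open import Relation.Binary.PropositionalEquality
  using (_≡_; _≗_; refl; sym; trans; cong; cong₂; subst; module ≡-Reasoning)
open import Relation.Nullary using (¬_; Dec; yes; no; contradiction; _×-dec_; _→-dec_)
open import Relation.Unary using (Decidable)

open Equivalence using (to; from)

-- Formal power series

-- No series is ever inverted. Each generating function enters only through a relation between its
-- versions for parts up to m and up to m + 1, with denominators moved to the other side as
-- `factor`s. These are cancelled at the end, which is possible because 1 + ε qᵏ with k > 0 has
-- constant term 1. The cut-off m keeps alphabets and products finite, but for fixed m the identity
-- holds only up to qᵐ: the restricted pod series is the product of the other two times ∏ (1 - qᵏ)
-- over the even k with m < k ≤ 2m. Since the n-th coefficients no longer change once m ≥ n, the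
-- choice m = n suffices in the end. All three counts are instances of one enumeration of words in
-- which every letter carries a weight ε, namely -1 for A and 1 for the other two.

Series : Set
Series = ℕ → ℤ

δ : Series
δ zero    = 1ℤ
δ (suc _) = 0ℤ

mulX : Series → Series
mulX f zero    = 0ℤ
mulX f (suc n) = f n

shift : ℕ → Series → Series
shift zero    f = f
shift (suc k) f = mulX (shift k f)

-- Multiplication by 1 + ε qᵏ.
factor : ℤ → ℕ → Series → Series
factor ε k f n = f n + ε * shift k f n

-- The Cauchy product, obtained by writing the left series as its constant term plus q times the
-- rest; induction on the degree then moves along the left series.
conv : Series → Series → Series
conv f g zero    = f 0 * g 0
conv f g (suc n) = f 0 * g (suc n) + conv (f ∘ suc) g n

mulX-cong : ∀ {f g} → f ≗ g → mulX f ≗ mulX g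
mulX-cong f≗g zero    = refl
mulX-cong f≗g (suc n) = f≗g n

shift-cong-≤ : ∀ k {f g n} → (∀ m → m ≤ n → f m ≡ g m) → shift k f n ≡ shift k g n
shift-cong-≤ zero            f≈g = f≈g _ ℕₚ.≤-refl
shift-cong-≤ (suc k) {n = zero}  f≈g = refl
shift-cong-≤ (suc k) {n = suc n} f≈g =
  shift-cong-≤ k (λ m m≤n → f≈g m (ℕₚ.m≤n⇒m≤1+n m≤n))

shift-cong-< : ∀ {k f g n} → 0 < k → (∀ m → m < n → f m ≡ g m) → shift k f n ≡ shift k g n
shift-cong-< {suc k} {n = zero}  _ f≈g = refl
shift-cong-< {suc k} {n = suc n} _ f≈g = shift-cong-≤ k (λ m m≤n → f≈g m (s≤s m≤n))

shift-< : ∀ {k f n} → n < k → shift k f n ≡ 0ℤ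
shift-< {suc k} {n = zero}  _         = refl
shift-< {suc k} {n = suc n} (s≤s n<k) = shift-< {k} n<k

shift-+ : ∀ k f m → shift k f (k ℕ.+ m) ≡ f m
shift-+ zero    f m = refl
shift-+ (suc k) f m = shift-+ k f m

shift-linear : ∀ k f g ε → shift k (λ n → f n + ε * g n) ≗ λ n → shift k f n + ε * shift k g n
shift-linear zero    f g ε n       = refl
shift-linear (suc k) f g ε zero    = sym (trans (ℤₚ.+-identityˡ _) (ℤₚ.*-zeroʳ ε))
shift-linear (suc k) f g ε (suc n) = shift-linear k f g ε n

shift-shift : ∀ k l f → shift k (shift l f) ≗ shift (k ℕ.+ l) f
shift-shift zero    l f n = refl
shift-shift (suc k) l f n = mulX-cong (shift-shift k l f) n

shift-comm : ∀ k l f → shift k (shift l f) ≗ shift l (shift k f)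
shift-comm k l f n = begin
  shift k (shift l f) n  ≡⟨ shift-shift k l f n ⟩
  shift (k ℕ.+ l) f n    ≡⟨ cong (λ i → shift i f n) (ℕₚ.+-comm k l) ⟩
  shift (l ℕ.+ k) f n    ≡⟨ shift-shift l k f n ⟨
  shift l (shift k f) n  ∎
  where open ≡-Reasoning

factor-cong-≤ : ∀ ε k {f g n} → (∀ m → m ≤ n → f m ≡ g m) → factor ε k f n ≡ factor ε k g n
factor-cong-≤ ε k f≈g = cong₂ (λ x y → x + ε * y) (f≈g _ ℕₚ.≤-refl) (shift-cong-≤ k f≈g)

factor-cong : ∀ ε k {f g} → f ≗ g → factor ε k f ≗ factor ε k g
factor-cong ε k f≗g n = factor-cong-≤ ε k (λ m _ → f≗g m)

factor-> : ∀ ε {k n} f → n < k → factor ε k f n ≡ f n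
factor-> ε {k} {n} f n<k = begin
  f n + ε * shift k f n  ≡⟨ cong (λ x → f n + ε * x) (shift-< {k} n<k) ⟩
  f n + ε * 0ℤ           ≡⟨ cong (_+_ (f n)) (ℤₚ.*-zeroʳ ε) ⟩
  f n + 0ℤ               ≡⟨ ℤₚ.+-identityʳ (f n) ⟩
  f n                    ∎
  where open ≡-Reasoning

factor-comm : ∀ ε k ε′ l f → factor ε k (factor ε′ l f) ≗ factor ε′ l (factor ε k f)
factor-comm ε k ε′ l f n = begin
  (f n + ε′ * y) + ε * shift k (factor ε′ l f) n
    ≡⟨ cong (λ t → (f n + ε′ * y) + ε * t) (shift-linear k f (shift l f) ε′ n) ⟩
  (f n + ε′ * y) + ε * (x + ε′ * shift k (shift l f) n)
    ≡⟨ cong (λ t → (f n + ε′ * y) + ε * (x + ε′ * t)) (shift-comm k l f n) ⟩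
  (f n + ε′ * y) + ε * (x + ε′ * z)
    ≡⟨ lemma (f n) x y z ε ε′ ⟩
  (f n + ε * x) + ε′ * (y + ε * z)
    ≡⟨ cong (λ t → (f n + ε * x) + ε′ * t) (shift-linear l f (shift k f) ε n) ⟨
  (f n + ε * x) + ε′ * shift l (factor ε k f) n ∎
  where
  open ≡-Reasoning
  x = shift k f n
  y = shift l f n
  z = shift l (shift k f) n
  lemma : ∀ a x y z e d → (a + d * y) + e * (x + d * z) ≡ (a + e * x) + d * (y + e * z)
  lemma = solve-∀

factor-difference-of-squares : ∀ k f → factor -1ℤ k (factor 1ℤ k f) ≗ factor -1ℤ (k ℕ.+ k) f
factor-difference-of-squares k f n = begin
  (f n + 1ℤ * x) + -1ℤ * shift k (factor 1ℤ k f) n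
    ≡⟨ cong (λ t → (f n + 1ℤ * x) + -1ℤ * t) (shift-linear k f (shift k f) 1ℤ n) ⟩
  (f n + 1ℤ * x) + -1ℤ * (x + 1ℤ * shift k (shift k f) n)
    ≡⟨ lemma (f n) x (shift k (shift k f) n) ⟩
  f n + -1ℤ * shift k (shift k f) n
    ≡⟨ cong (λ t → f n + -1ℤ * t) (shift-shift k k f n) ⟩
  f n + -1ℤ * shift (k ℕ.+ k) f n ∎
  where
  open ≡-Reasoning
  x = shift k f n
  lemma : ∀ a x y → (a + 1ℤ * x) + -1ℤ * (x + 1ℤ * y) ≡ a + -1ℤ * y
  lemma = solve-∀

-- Since k > 0, coefficient n of the product is `f n` plus a term in strictly lower coefficients, so
-- strong induction recovers `f`. The bound N is kept because the finite products to be compared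
-- agree only that far.
factor-cancel-≤ : ∀ ε f g {k N} → 0 < k →
  (∀ n → n ≤ N → factor ε k f n ≡ factor ε k g n) → ∀ n → n ≤ N → f n ≡ g n
-- Strong induction on n, run as structural recursion on a strict upper bound b.
factor-cancel-≤ ε f g {k} {N} 0<k eq = λ n n≤N → below (suc n) n ℕₚ.≤-refl n≤N
  where
  cancel : ∀ n → n ≤ N → shift k f n ≡ shift k g n → f n ≡ g n
  cancel n n≤N tails = ∙-cancelʳ (ε * shift k f n) (f n) (g n)
    (trans (eq n n≤N) (cong (λ t → g n + ε * t) (sym tails)))
  below : ∀ b n → n < b → n ≤ N → f n ≡ g n
  below (suc b) n (s≤s n≤b) n≤N = cancel n n≤N (shift-cong-< 0<k
    (λ m m<n → below b m (ℕₚ.<-≤-trans m<n n≤b) (ℕₚ.≤-trans (ℕₚ.<⇒≤ m<n) n≤N)))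

factor-cancel : ∀ ε f g {k} → 0 < k → factor ε k f ≗ factor ε k g → f ≗ g
factor-cancel ε f g 0<k eq n = factor-cancel-≤ ε f g 0<k (λ m _ → eq m) n ℕₚ.≤-refl

conv-cong : ∀ {f f′ g g′} → f ≗ f′ → g ≗ g′ → conv f g ≗ conv f′ g′
conv-cong f≗ g≗ zero    = cong₂ _*_ (f≗ 0) (g≗ 0)
conv-cong f≗ g≗ (suc n) =
  cong₂ _+_ (cong₂ _*_ (f≗ 0) (g≗ (suc n))) (conv-cong (f≗ ∘ suc) g≗ n)

conv-cong-≤ : ∀ {f f′ g g′} N → (∀ n → n ≤ N → f n ≡ f′ n) → (∀ n → n ≤ N → g n ≡ g′ n) →
  conv f g N ≡ conv f′ g′ N
conv-cong-≤ zero    f≈ g≈ = cong₂ _*_ (f≈ 0 z≤n) (g≈ 0 z≤n)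
conv-cong-≤ (suc n) f≈ g≈ =
  cong₂ _+_ (cong₂ _*_ (f≈ 0 z≤n) (g≈ (suc n) ℕₚ.≤-refl))
            (conv-cong-≤ n (λ m m≤n → f≈ (suc m) (s≤s m≤n)) (λ m m≤n → g≈ m (ℕₚ.m≤n⇒m≤1+n m≤n)))

conv-identityˡ : ∀ g → conv δ g ≗ g
conv-identityˡ g zero    = ℤₚ.*-identityˡ (g 0)
conv-identityˡ g (suc n) = trans (cong (_+_ (1ℤ * g (suc n))) (zeros n)) (lemma (g (suc n)))
  where
  zeros : ∀ n → conv (λ _ → 0ℤ) g n ≡ 0ℤ
  zeros zero    = refl
  zeros (suc n) = trans (ℤₚ.+-identityˡ _) (zeros n)
  lemma : ∀ x → 1ℤ * x + 0ℤ ≡ x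
  lemma = solve-∀

conv-linearˡ : ∀ f f′ g ε → conv (λ n → f n + ε * f′ n) g ≗ λ n → conv f g n + ε * conv f′ g n
conv-linearˡ f f′ g ε zero = lemma (f 0) (f′ 0) (g 0) ε
  where
  lemma : ∀ a b c e → (a + e * b) * c ≡ a * c + e * (b * c)
  lemma = solve-∀
conv-linearˡ f f′ g ε (suc n) = trans
  (cong (_+_ ((f 0 + ε * f′ 0) * g (suc n))) (conv-linearˡ (f ∘ suc) (f′ ∘ suc) g ε n))
  (lemma (f 0) (f′ 0) (g (suc n)) ε (conv (f ∘ suc) g n) (conv (f′ ∘ suc) g n))
  where
  lemma : ∀ a b c e x y → (a + e * b) * c + (x + e * y) ≡ (a * c + x) + e * (b * c + y)
  lemma = solve-∀

conv-linearʳ : ∀ f g g′ ε → conv f (λ n → g n + ε * g′ n) ≗ λ n → conv f g n + ε * conv f g′ n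
conv-linearʳ f g g′ ε zero = lemma (f 0) (g 0) (g′ 0) ε
  where
  lemma : ∀ a b c e → a * (b + e * c) ≡ a * b + e * (a * c)
  lemma = solve-∀
conv-linearʳ f g g′ ε (suc n) = trans
  (cong (_+_ (f 0 * (g (suc n) + ε * g′ (suc n)))) (conv-linearʳ (f ∘ suc) g g′ ε n))
  (lemma (f 0) (g (suc n)) (g′ (suc n)) ε (conv (f ∘ suc) g n) (conv (f ∘ suc) g′ n))
  where
  lemma : ∀ a b c e x y → a * (b + e * c) + (x + e * y) ≡ (a * b + x) + e * (a * c + y)
  lemma = solve-∀

conv-mulXˡ : ∀ f g → conv (mulX f) g ≗ mulX (conv f g)
conv-mulXˡ f g zero    = refl
conv-mulXˡ f g (suc n) = ℤₚ.+-identityˡ _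

conv-mulXʳ : ∀ f g → conv f (mulX g) ≗ mulX (conv f g)
conv-mulXʳ f g zero          = ℤₚ.*-zeroʳ (f 0)
conv-mulXʳ f g (suc zero)    = trans (cong (_+_ (f 0 * g 0)) (ℤₚ.*-zeroʳ (f 1))) (ℤₚ.+-identityʳ _)
conv-mulXʳ f g (suc (suc n)) = cong (_+_ (f 0 * g (suc n))) (conv-mulXʳ (f ∘ suc) g (suc n))

conv-shiftˡ : ∀ k f g → conv (shift k f) g ≗ shift k (conv f g)
conv-shiftˡ zero    f g n = refl
conv-shiftˡ (suc k) f g n =
  trans (conv-mulXˡ (shift k f) g n) (mulX-cong (conv-shiftˡ k f g) n)

conv-shiftʳ : ∀ k f g → conv f (shift k g) ≗ shift k (conv f g)
conv-shiftʳ zero    f g n = refl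
conv-shiftʳ (suc k) f g n =
  trans (conv-mulXʳ f (shift k g) n) (mulX-cong (conv-shiftʳ k f g) n)

conv-factorˡ : ∀ ε k f g → conv (factor ε k f) g ≗ factor ε k (conv f g)
conv-factorˡ ε k f g n = trans (conv-linearˡ f (shift k f) g ε n)
  (cong (λ t → conv f g n + ε * t) (conv-shiftˡ k f g n))

conv-factorʳ : ∀ ε k f g → conv f (factor ε k g) ≗ factor ε k (conv f g)
conv-factorʳ ε k f g n = trans (conv-linearʳ f g (shift k g) ε n)
  (cong (λ t → conv f g n + ε * t) (conv-shiftʳ k f g n))

-- Multiplication by the product of the 1 - qᵏ over the listed k.
prod : List ℕ → Series → Series
prod []       f = f
prod (k ∷ ks) f = prod ks (factor -1ℤ k f)

prod-cong-≤ : ∀ ks {f g N} → (∀ n → n ≤ N → f n ≡ g n) → ∀ n → n ≤ N → prod ks f n ≡ prod ks g n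
prod-cong-≤ []       f≈g = f≈g
prod-cong-≤ (k ∷ ks) f≈g = prod-cong-≤ ks
  (λ n n≤N → factor-cong-≤ -1ℤ k (λ m m≤n → f≈g m (ℕₚ.≤-trans m≤n n≤N)))

prod-cong : ∀ ks {f g} → f ≗ g → prod ks f ≗ prod ks g
prod-cong ks f≗g n = prod-cong-≤ ks (λ m _ → f≗g m) n ℕₚ.≤-refl

prod-factor : ∀ ks ε k f → prod ks (factor ε k f) ≗ factor ε k (prod ks f)
prod-factor []       ε k f n = refl
prod-factor (l ∷ ks) ε k f n = trans
  (prod-cong ks (factor-comm -1ℤ l ε k f) n) (prod-factor ks ε k (factor -1ℤ l f) n)

prod-comm : ∀ ks ls f → prod ks (prod ls f) ≗ prod ls (prod ks f)
prod-comm []       ls f n = refl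
prod-comm (k ∷ ks) ls f n = trans
  (prod-cong ks (λ m → sym (prod-factor ls -1ℤ k f m)) n) (prod-comm ks ls (factor -1ℤ k f) n)

prod-cancel-≤ : ∀ f g {ks N} → All (0 <_) ks →
  (∀ n → n ≤ N → prod ks f n ≡ prod ks g n) → ∀ n → n ≤ N → f n ≡ g n
prod-cancel-≤ f g []                       eq = eq
prod-cancel-≤ f g {k ∷ ks} (0<k ∷ 0<ks) eq =
  factor-cancel-≤ -1ℤ f g 0<k (prod-cancel-≤ (factor -1ℤ k f) (factor -1ℤ k g) 0<ks eq)

-- The infinite sum as a convolution

partialSum-cong : ∀ {f g : ℕ → ℤ} → f ≗ g → partialSum f ≗ partialSum g
partialSum-cong f≗g zero    = refl
partialSum-cong f≗g (suc n) = cong₂ _+_ (partialSum-cong f≗g n) (f≗g n)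

partialSum-head : ∀ h n → partialSum h (suc n) ≡ h 0 + partialSum (h ∘ suc) n
partialSum-head h zero    = trans (ℤₚ.+-identityˡ (h 0)) (sym (ℤₚ.+-identityʳ (h 0)))
partialSum-head h (suc n) = trans (cong (_+ h (suc n)) (partialSum-head h n))
  (ℤₚ.+-assoc (h 0) (partialSum (h ∘ suc) n) (h (suc n)))

suc-minus-suc : ∀ n j → + suc n - + suc j ≡ + n - + j
suc-minus-suc n j = begin
  + suc n - + suc j  ≡⟨ ℤₚ.[+m]-[+n]≡m⊖n (suc n) (suc j) ⟩
  suc n ℤ.⊖ suc j    ≡⟨ ℤₚ.[1+m]⊖[1+n]≡m⊖n n j ⟩
  n ℤ.⊖ j            ≡⟨ ℤₚ.[+m]-[+n]≡m⊖n n j ⟨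
  + n - + j          ∎
  where open ≡-Reasoning

convolution-sumsTo : ∀ (f : Series) (g : ℤ → ℤ) → (∀ k → g -[1+ k ] ≡ 0ℤ) →
  ∀ n → (λ j → f j * g (+ n - + j)) SumsTo conv f (g ∘ +_) n
-- `partialSum` stops before its index, so the term j = n enters at `suc n`; from there on n - j is
-- negative and every further term vanishes.
convolution-sumsTo f g g-neg n = suc n , stable
  where
  total : ∀ f n → partialSum (λ j → f j * g (+ n - + j)) (suc n) ≡ conv f (g ∘ +_) n
  total f zero    = ℤₚ.+-identityˡ _
  total f (suc n) = begin
    partialSum (λ j → f j * g (+ suc n - + j)) (suc (suc n))
      ≡⟨ partialSum-head (λ j → f j * g (+ suc n - + j)) (suc n) ⟩
    f 0 * g (+ suc n - + 0) + partialSum (λ j → f (suc j) * g (+ suc n - + suc j)) (suc n)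
      ≡⟨ cong₂ (λ x y → f 0 * g x + y) (ℤₚ.+-identityʳ (+ suc n))
           (partialSum-cong (λ j → cong (λ x → f (suc j) * g x) (suc-minus-suc n j)) (suc n)) ⟩
    f 0 * g (+ suc n) + partialSum (λ j → f (suc j) * g (+ n - + j)) (suc n)
      ≡⟨ cong (_+_ (f 0 * g (+ suc n))) (total (f ∘ suc) n) ⟩
    f 0 * g (+ suc n) + conv (f ∘ suc) (g ∘ +_) n ∎
    where open ≡-Reasoning
  beyond : ∀ n j → g (+ n - + suc (n ℕ.+ j)) ≡ 0ℤ
  beyond zero    j = g-neg j
  beyond (suc n) j = trans (cong g (suc-minus-suc n (suc (n ℕ.+ j)))) (beyond n j)
  tail : ∀ d → partialSum (λ j → f j * g (+ n - + j)) (suc n ℕ.+ d) ≡ conv f (g ∘ +_) n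
  tail zero    = trans (cong (partialSum _) (ℕₚ.+-identityʳ (suc n))) (total f n)
  tail (suc d) = begin
    partialSum h (suc n ℕ.+ suc d)                   ≡⟨ cong (partialSum h) (ℕₚ.+-suc (suc n) d) ⟩
    partialSum h (suc n ℕ.+ d) + h (suc n ℕ.+ d)
      ≡⟨ cong₂ _+_ (tail d) (cong (f (suc n ℕ.+ d) *_) (beyond n d)) ⟩
    conv f (g ∘ +_) n + f (suc n ℕ.+ d) * 0ℤ
      ≡⟨ cong (_+_ (conv f (g ∘ +_) n)) (ℤₚ.*-zeroʳ (f (suc n ℕ.+ d))) ⟩
    conv f (g ∘ +_) n + 0ℤ                           ≡⟨ ℤₚ.+-identityʳ _ ⟩
    conv f (g ∘ +_) n                                ∎
    where
    open ≡-Reasoning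
    h = λ j → f j * g (+ n - + j)
  stable : ∀ m → suc n ≤ m → partialSum (λ j → f j * g (+ n - + j)) m ≡ conv f (g ∘ +_) n
  stable m n<m = trans (cong (partialSum _) (sym (ℕₚ.m+[n∸m]≡n n<m))) (tail (m ℕ.∸ suc n))

-- Signed enumeration of words

module _ {L : Set} where

  -- For ε = 1 this is the number of words; for ε = -1 it is the number of words of even length
  -- minus that of odd length.
  total : ℤ → List (List L) → ℤ
  total ε []       = 0ℤ
  total ε (l ∷ ls) = ε ℤ.^ length l + total ε ls

  total-++ : ∀ ε ks ls → total ε (ks ++ ls) ≡ total ε ks + total ε ls
  total-++ ε []       ls = sym (ℤₚ.+-identityˡ _)
  total-++ ε (k ∷ ks) ls = trans (cong (_+_ (ε ℤ.^ length k)) (total-++ ε ks ls))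
    (sym (ℤₚ.+-assoc (ε ℤ.^ length k) (total ε ks) (total ε ls)))

  total-map-∷ : ∀ ε (a : L) ls → total ε (map (a ∷_) ls) ≡ ε * total ε ls
  total-map-∷ ε a []       = sym (ℤₚ.*-zeroʳ ε)
  total-map-∷ ε a (l ∷ ls) = trans (cong (_+_ (ε * ε ℤ.^ length l)) (total-map-∷ ε a ls))
    (sym (ℤₚ.*-distribˡ-+ ε (ε ℤ.^ length l) (total ε ls)))

  total-↭ : ∀ ε {ks ls : List (List L)} → ks ↭ ls → total ε ks ≡ total ε ls
  total-↭ ε ↭.refl = refl
  total-↭ ε (↭.prep x p) = cong (_+_ (ε ℤ.^ length x)) (total-↭ ε p)
  total-↭ ε (↭.swap {ks} {ls} x y p) = trans (lemma (ε ℤ.^ length x) (ε ℤ.^ length y) (total ε ks))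
    (cong (λ t → ε ℤ.^ length y + (ε ℤ.^ length x + t)) (total-↭ ε p))
    where
    lemma : ∀ a b c → a + (b + c) ≡ b + (a + c)
    lemma = solve-∀
  total-↭ ε (↭.trans p q) = trans (total-↭ ε p) (total-↭ ε q)

  -- Duplicate-free lists with the same members are permutations of each other, and the weighted sum
  -- ignores order. Identities between counts thus reduce to membership in both directions.
  total-unique : ∀ ε {ks ls : List (List L)} → Unique ks → Unique ls →
    (∀ {l} → l ∈ ks ⇔ l ∈ ls) → total ε ks ≡ total ε ls
  total-unique ε !ks !ls eq = total-↭ ε (∼bag⇒↭ (unique∧set⇒bag !ks !ls eq))

  ∈-listsUpTo⁺ : ∀ {as : List L} {k l} → All (_∈ as) l → length l ≤ k → l ∈ listsUpTo as k
  ∈-listsUpTo⁺ {k = zero}  []           _         = here refl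
  ∈-listsUpTo⁺ {k = suc k} []           _         = here refl
  ∈-listsUpTo⁺ {k = suc k} (a∈as ∷ all) (s≤s len) =
    there (∈-cartesianProductWith⁺ _∷_ a∈as (∈-listsUpTo⁺ all len))

  ∈-listsUpTo⁻ : ∀ (as : List L) k {l} → l ∈ listsUpTo as k → All (_∈ as) l
  ∈-listsUpTo⁻ as zero    (here refl) = []
  ∈-listsUpTo⁻ as (suc k) (here refl) = []
  ∈-listsUpTo⁻ as (suc k) (there l∈)
    with _ , _ , a∈as , l∈′ , refl ← ∈-cartesianProductWith⁻ _∷_ as (listsUpTo as k) l∈
    = a∈as ∷ ∈-listsUpTo⁻ as k l∈′

  listsUpTo-unique : ∀ {as : List L} k → Unique as → Unique (listsUpTo as k)
  listsUpTo-unique zero    !as = [] ∷ []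
  listsUpTo-unique {as} (suc k) !as = All.tabulate distinct ∷
    Unique.cartesianProductWith⁺ _∷_ (λ { refl → refl , refl }) !as (listsUpTo-unique k !as)
    where
    distinct : ∀ {l} → l ∈ cartesianProductWith _∷_ as (listsUpTo as k) → ¬ [] ≡ l
    distinct l∈ refl with () ← ∈-cartesianProductWith⁻ _∷_ as (listsUpTo as k) l∈

-- Words are multisets of decorated parts listed in decreasing order; T is the tie
-- rule for letters of equal size, and a letter a is repeatable when T a a holds.
module Words {L : Set} (size : L → ℕ) (T : L → L → Set) (T? : ∀ a b → Dec (T a b)) (ε : ℤ) where

  R : L → L → Set
  R a b = size b ≤ size a × (size a ≡ size b → T a b)

  R? : ∀ a b → Dec (R a b)
  R? a b = size b ℕ.≤? size a ×-dec (size a ℕ.≟ size b →-dec T? a b)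

  -- If the outer sizes are equal, the middle one is squeezed to the same value, so only the tie
  -- rule has to be transitive.
  R-trans : (∀ {a b c} → T a b → T b c → T a c) → ∀ {a b c} → R a b → R b c → R a c
  R-trans T-trans {a} {b} {c} (b≤a , Tab) (c≤b , Tbc) = ℕₚ.≤-trans c≤b b≤a , λ a≡c →
    let a≡b = ℕₚ.≤-antisym (subst (_≤ size b) (sym a≡c) c≤b) b≤a
    in T-trans (Tab a≡b) (Tbc (trans (sym a≡b) a≡c))

  -- `AllPairs` relates the head to every later letter, so removing the head leaves a word over the
  -- letters that it may precede.
  Word : ℕ → List L → Set
  Word n l = AllPairs R l × sum (map size l) ≡ n

  word? : ∀ n → Decidable (Word n)
  word? n l = allPairs? R? l ×-dec sum (map size l) ℕ.≟ n

  words : List L → ℕ → List (List L)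
  words as n = filter (word? n) (listsUpTo as n)

  count : List L → Series
  count as n = total ε (words as n)

  count-[] : count [] ≗ δ
  count-[] zero    = refl
  count-[] (suc n) = refl

  length≤sum : ∀ {l} → All (λ a → 0 < size a) l → length l ≤ sum (map size l)
  length≤sum []          = z≤n
  length≤sum (0<a ∷ 0<l) = ℕₚ.+-mono-≤ 0<a (length≤sum 0<l)

  size≤sum : ∀ l → All (λ a → size a ≤ sum (map size l)) l
  size≤sum []      = []
  size≤sum (a ∷ l) = ℕₚ.m≤m+n (size a) _ ∷
    All.map (λ ≤sum → ℕₚ.≤-trans ≤sum (ℕₚ.m≤n+m _ (size a))) (size≤sum l)

  Positive : List L → Set
  Positive as = ∀ {a} → a ∈ as → 0 < size a

  ∈-words⁺ : ∀ {as n l} → Positive as → All (_∈ as) l → Word n l → l ∈ words as n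
  ∈-words⁺ {n = n} pos all word@(_ , sum≡n) = ∈-filter⁺ (word? n)
    (∈-listsUpTo⁺ all (subst (_ ≤_) sum≡n (length≤sum (All.map pos all)))) word

  ∈-words⁻ : ∀ as n {l} → l ∈ words as n → All (_∈ as) l × Word n l
  ∈-words⁻ as n l∈ with l∈lists , word ← ∈-filter⁻ (word? n) l∈ =
    ∈-listsUpTo⁻ as n l∈lists , word

  words-unique : ∀ {as} n → Unique as → Unique (words as n)
  words-unique n !as = Unique.filter⁺ (word? n) (listsUpTo-unique n !as)

  -- All occurrences of such an `a` stand at the front of a word over `a ∷ as`, so `a` can be split
  -- off from the head alone.
  Dominates : L → List L → Set
  Dominates a as = ∀ {b} → b ∈ as → R a b × ¬ R b a

  -- The tails of words over a ∷ as that begin with a are the words over bs, which is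
  -- a ∷ as or as according to whether a is repeatable.
  module _ {a : L} {as bs : List L} (pos : Positive (a ∷ as)) (!a∷as : Unique (a ∷ as))
    (!bs : Unique bs) (dom : Dominates a as)
    (bs⁻ : ∀ {b} → b ∈ bs → b ∈ a ∷ as × R a b)
    (bs⁺ : ∀ {b} → b ∈ a ∷ as → R a b → b ∈ bs) where

    -- If the head lies in `as`, then `a` cannot occur later, because no letter of `as` may precede
    -- it. If the head is `a`, the tail uses only letters that `a` may precede, and these make up
    -- `bs`.
    split : ∀ {l} → All (_∈ a ∷ as) l → AllPairs R l →
      All (_∈ as) l ⊎ ∃ λ l′ → l ≡ a ∷ l′ × All (_∈ bs) l′
    split []                [] = inj₁ []
    split (here refl ∷ all) (Ra ∷ _) =
      inj₂ (_ , refl , All.zipWith (λ (c∈ , Rac) → bs⁺ c∈ Rac) (all , Ra))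
    split (there b∈as ∷ all) (Rb ∷ _) = inj₁ (b∈as ∷ All.zipWith smaller (all , Rb))
      where
      smaller : ∀ {c} → c ∈ a ∷ as × R _ c → c ∈ as
      smaller (here refl  , Rba) = contradiction Rba (proj₂ (dom b∈as))
      smaller (there c∈as , _)   = c∈as

    !as : Unique as
    !as = AllPairs.tail !a∷as

    a∉as : ¬ a ∈ as
    a∉as a∈as = proj₂ (dom a∈as) (proj₁ (dom a∈as))

    count-∷-< : ∀ {n} → n < size a → count (a ∷ as) n ≡ count as n
    count-∷-< {n} n<a = total-unique ε (words-unique n !a∷as) (words-unique n !as) (mk⇔ forth back)
      where
      forth : ∀ {l} → l ∈ words (a ∷ as) n → l ∈ words as n
      forth l∈ with all , word@(pairs , sum≡n) ← ∈-words⁻ (a ∷ as) n l∈ with split all pairs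
      ... | inj₁ all′ = ∈-words⁺ (pos ∘ there) all′ word
      ... | inj₂ (l′ , refl , _) =
        contradiction (subst (size a ≤_) sum≡n (ℕₚ.m≤m+n (size a) _)) (ℕₚ.<⇒≱ n<a)
      back : ∀ {l} → l ∈ words as n → l ∈ words (a ∷ as) n
      back l∈ with all , word ← ∈-words⁻ as n l∈ = ∈-words⁺ pos (All.map there all) word

    count-∷-≥ : ∀ m → count (a ∷ as) (size a ℕ.+ m) ≡ count as (size a ℕ.+ m) + ε * count bs m
    count-∷-≥ m = begin
      total ε (words (a ∷ as) n)
        ≡⟨ total-unique ε (words-unique n !a∷as) !split (mk⇔ forth back) ⟩
      total ε (words as n ++ map (a ∷_) (words bs m))
        ≡⟨ total-++ ε (words as n) _ ⟩
      count as n + total ε (map (a ∷_) (words bs m))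
        ≡⟨ cong (_+_ (count as n)) (total-map-∷ ε a (words bs m)) ⟩
      count as n + ε * count bs m ∎
      where
      open ≡-Reasoning
      n = size a ℕ.+ m
      !split : Unique (words as n ++ map (a ∷_) (words bs m))
      !split = Unique.++⁺ (words-unique n !as)
        (Unique.map⁺ (λ { refl → refl }) (words-unique m !bs)) disjoint
        where
        disjoint : ∀ {l} → ¬ (l ∈ words as n × l ∈ map (a ∷_) (words bs m))
        disjoint (l∈ , l∈′) with _ , _ , refl ← ∈-map⁻ (a ∷_) l∈′
          with a∈as ∷ _ , _ ← ∈-words⁻ as n l∈ = a∉as a∈as
      forth : ∀ {l} → l ∈ words (a ∷ as) n → l ∈ words as n ++ map (a ∷_) (words bs m)
      forth l∈ with all , word@(pairs , sum≡n) ← ∈-words⁻ (a ∷ as) n l∈ with split all pairs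
      ... | inj₁ all′ = ∈-++⁺ˡ (∈-words⁺ (pos ∘ there) all′ word)
      forth l∈ | inj₂ (l′ , refl , all′) with _ ∷ pairs′ ← pairs =
        ∈-++⁺ʳ (words as n) (∈-map⁺ (a ∷_) (∈-words⁺ (pos ∘ proj₁ ∘ bs⁻) all′
          (pairs′ , ℕₚ.+-cancelˡ-≡ (size a) _ _ sum≡n)))
      back : ∀ {l} → l ∈ words as n ++ map (a ∷_) (words bs m) → l ∈ words (a ∷ as) n
      back l∈ with ∈-++⁻ (words as n) l∈
      ... | inj₁ l∈as with all , word ← ∈-words⁻ as n l∈as = ∈-words⁺ pos (All.map there all) word
      ... | inj₂ l∈bs with l′ , l′∈ , refl ← ∈-map⁻ (a ∷_) l∈bs
        with all , pairs , sum≡m ← ∈-words⁻ bs m l′∈ =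
        ∈-words⁺ pos (here refl ∷ All.map (proj₁ ∘ bs⁻) all)
          (All.map (proj₂ ∘ bs⁻) all ∷ pairs , cong (size a ℕ.+_) sum≡m)

    -- A word either avoids `a` or is `a` followed by a word over `bs`; the prefix contributes the
    -- weight ε and raises the sum by `size a`. Below `size a` the second kind is absent, as is the
    -- shifted term.
    count-∷ : ∀ n → count (a ∷ as) n ≡ count as n + ε * shift (size a) (count bs) n
    count-∷ n with n ℕ.<? size a
    ... | yes n<a = trans (count-∷-< n<a) (sym (factorless n<a))
      where
      factorless : ∀ {k} → n < k → count as n + ε * shift k (count bs) n ≡ count as n
      factorless {k} n<k = trans (cong (λ t → count as n + ε * t) (shift-< {k} n<k))
        (trans (cong (_+_ (count as n)) (ℤₚ.*-zeroʳ ε)) (ℤₚ.+-identityʳ _))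
    ... | no n≮a = subst (λ i → count (a ∷ as) i ≡ count as i + ε * shift (size a) (count bs) i)
      (ℕₚ.m+[n∸m]≡n (ℕₚ.≮⇒≥ n≮a))
      (trans (count-∷-≥ m) (cong (λ t → count as (size a ℕ.+ m) + ε * t)
        (sym (shift-+ (size a) (count bs) m))))
      where
      m = n ℕ.∸ size a

  module _ {a : L} {as : List L} (pos : Positive (a ∷ as)) (!a∷as : Unique (a ∷ as))
    (dom : Dominates a as) where

    -- With `bs` = `a ∷ as` the recursion reads F = G + ε qᵏ F, which is the geometric series F = G
    -- / (1 - ε qᵏ) without division.
    count-repeatable : R a a → factor (- ε) (size a) (count (a ∷ as)) ≗ count as
    count-repeatable Raa n = trans
      (cong (λ t → t + - ε * shift (size a) (count (a ∷ as)) n)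
        (count-∷ pos !a∷as !a∷as dom bs⁻ (λ b∈ _ → b∈) n))
      (lemma (count as n) ε _)
      where
      bs⁻ : ∀ {b} → b ∈ a ∷ as → b ∈ a ∷ as × R a b
      bs⁻ (here refl) = here refl , Raa
      bs⁻ (there b∈)  = there b∈ , proj₁ (dom b∈)
      lemma : ∀ x e y → (x + e * y) + - e * y ≡ x
      lemma = solve-∀

    -- Here `a` may not follow itself, so `bs` = `as` and the recursion is already the claim.
    count-distinct : ¬ R a a → count (a ∷ as) ≗ factor ε (size a) (count as)
    count-distinct ¬Raa =
      count-∷ pos !a∷as (AllPairs.tail !a∷as) dom (λ b∈ → there b∈ , proj₁ (dom b∈)) bs⁺
      where
      bs⁺ : ∀ {b} → b ∈ a ∷ as → R a b → b ∈ as
      bs⁺ (here refl) Raa = contradiction Raa ¬Raa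
      bs⁺ (there b∈)  _   = b∈

  module Blocks (block : ℕ → List L) (block-size : ∀ k {a} → a ∈ block k → size a ≡ k)
    (block-unique : ∀ k → Unique (block k)) where

    -- Larger parts come first, as in the non-increasing words, so each newly added letter dominates
    -- the alphabet of smaller parts.
    alphabet : ℕ → List L
    alphabet zero    = []
    alphabet (suc m) = block (suc m) ++ alphabet m

    Valid : L → Set
    Valid a = 0 < size a × a ∈ block (size a)

    ∈-alphabet⁻ : ∀ m {a} → a ∈ alphabet m → Valid a × size a ≤ m
    ∈-alphabet⁻ (suc m) a∈ with ∈-++⁻ (block (suc m)) a∈
    ... | inj₁ a∈block = subst (λ k → (0 < k × _ ∈ block k) × k ≤ suc m)
      (sym (block-size (suc m) a∈block)) ((s≤s z≤n , a∈block) , ℕₚ.≤-refl)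
    ... | inj₂ a∈rest with valid , a≤m ← ∈-alphabet⁻ m a∈rest = valid , ℕₚ.m≤n⇒m≤1+n a≤m

    ∈-alphabet⁺ : ∀ m {a} → Valid a → size a ≤ m → a ∈ alphabet m
    ∈-alphabet⁺ zero (0<a , _) a≤0 = contradiction 0<a (ℕₚ.≤⇒≯ a≤0)
    ∈-alphabet⁺ (suc m) {a} valid@(_ , a∈) a≤1+m with ℕₚ.m≤n⇒m<n∨m≡n a≤1+m
    ... | inj₁ (s≤s a≤m) = ∈-++⁺ʳ (block (suc m)) (∈-alphabet⁺ m valid a≤m)
    ... | inj₂ a≡1+m = ∈-++⁺ˡ (subst (λ k → a ∈ block k) a≡1+m a∈)

    alphabet-positive : ∀ m → Positive (alphabet m)
    alphabet-positive m = proj₁ ∘ proj₁ ∘ ∈-alphabet⁻ m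

    alphabet-unique : ∀ m → Unique (alphabet m)
    alphabet-unique zero    = []
    alphabet-unique (suc m) = Unique.++⁺ (block-unique (suc m)) (alphabet-unique m)
      λ (a∈block , a∈rest) → ℕₚ.<⇒≱ (ℕₚ.n<1+n m)
        (subst (_≤ m) (block-size (suc m) a∈block) (proj₂ (∈-alphabet⁻ m a∈rest)))

    alphabet-dominated : ∀ m {a} → size a ≡ suc m → Dominates a (alphabet m)
    alphabet-dominated m {a} a≡ {b} b∈ = (ℕₚ.<⇒≤ b<a , λ a≡b → contradiction (sym a≡b) (ℕₚ.<⇒≢ b<a)) ,
      λ (a≤b , _) → ℕₚ.<⇒≱ b<a a≤b
      where
      b<a : size b < size a
      b<a = subst (size b <_) (sym a≡) (s≤s (proj₂ (∈-alphabet⁻ m b∈)))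

    genFun : ℕ → Series
    genFun m = count (alphabet m)

    -- No letter exceeds the sum of its word, so letters larger than n never occur and every cut-off
    -- m ≥ n gives the same count. The searched letter list `as` may also contain invalid letters,
    -- since `P` rejects them.
    total-genFun : ∀ {P : List L → Set} (P? : Decidable P) {as n m} → n ≤ m → Unique as →
      (∀ {a} → Valid a → size a ≤ n → a ∈ as) →
      (∀ {l} → P l ⇔ (All Valid l × Word n l)) →
      total ε (filter P? (listsUpTo as n)) ≡ genFun m n
    total-genFun P? {as} {n} {m} n≤m !as ∈as P⇔ = total-unique ε
      (Unique.filter⁺ P? (listsUpTo-unique n !as)) (words-unique n (alphabet-unique m))
      (mk⇔ forth back)
      where
      forth : ∀ {l} → l ∈ filter P? (listsUpTo as n) → l ∈ words (alphabet m) n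
      forth {l} l∈ with ∈-filter⁻ P? {xs = listsUpTo as n} l∈
      ... | _ , Pl with valids , word@(_ , refl) ← to P⇔ Pl =
        ∈-words⁺ (alphabet-positive m)
          (All.zipWith (λ (valid , a≤n) → ∈-alphabet⁺ m valid (ℕₚ.≤-trans a≤n n≤m))
            (valids , size≤sum l))
          word
      back : ∀ {l} → l ∈ words (alphabet m) n → l ∈ filter P? (listsUpTo as n)
      back {l} l∈ with all , word@(_ , refl) ← ∈-words⁻ (alphabet m) n l∈ = ∈-filter⁺ P?
        (∈-listsUpTo⁺ (All.zipWith (λ (valid , a≤n) → ∈as valid a≤n) (valids , size≤sum l))
          (length≤sum (All.map proj₁ valids)))
        (from P⇔ (valids , word))
        where
        valids : All Valid l
        valids = All.map (proj₁ ∘ ∈-alphabet⁻ m) all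

-- The three counting functions

even⇒odd-suc : ∀ {n} → Even n → Odd (suc n)
even⇒odd-suc {n} even even-suc
  with s≤s () ← ∣⇒≤ (∣m+n∣m⇒∣n (subst (2 ∣_) (ℕₚ.+-comm 1 n) even-suc) even)

even-double : ∀ n → Even (n ℕ.+ n)
even-double n = subst Even (cong (n ℕ.+_) (ℕₚ.+-identityʳ n)) (m∣m*n n)

sign-parity : ∀ n → (Even n × -1ℤ ℤ.^ n ≡ 1ℤ) ⊎ (Odd n × -1ℤ ℤ.^ n ≡ -1ℤ)
sign-parity zero          = inj₁ (2 ∣0 , refl)
sign-parity (suc zero)    = inj₂ (even⇒odd-suc (2 ∣0) , refl)
sign-parity (suc (suc n)) with sign-parity n
... | inj₁ (even , sign) = inj₁ (∣m∣n⇒∣m+n ∣-refl even , trans (cong (λ x → -1ℤ * (-1ℤ * x)) sign) refl)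
... | inj₂ (odd  , sign) =
  inj₂ ((λ even → odd (∣m+n∣m⇒∣n even ∣-refl)) , cong (λ x → -1ℤ * (-1ℤ * x)) sign)

total-1 : ∀ {L : Set} (ls : List (List L)) → + length ls ≡ total 1ℤ ls
total-1 []       = refl
total-1 (l ∷ ls) = cong₂ _+_ (sym (ℤₚ.^-zeroˡ (length l))) (total-1 ls)

evens odds : ∀ {L : Set} → List (List L) → ℕ
evens ls = length (filter (λ l → even? (length l)) ls)
odds  ls = length (filter (λ l → odd? (length l)) ls)

total-signed : ∀ {L : Set} (ls : List (List L)) → + evens ls - + odds ls ≡ total -1ℤ ls
total-signed []       = refl
total-signed {L} (l ∷ ls) with sign-parity (length l)
... | inj₁ (even , sign)
  rewrite filter-accept (λ (l : List L) → even? (length l)) {l} {ls} even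
        | filter-reject (λ (l : List L) → odd? (length l)) {l} {ls} (λ odd → odd even)
        | sign
  = trans (ℤₚ.+-assoc 1ℤ (+ evens ls) (- + odds ls)) (cong (_+_ 1ℤ) (total-signed ls))
... | inj₂ (odd , sign)
  rewrite filter-reject (λ (l : List L) → even? (length l)) {l} {ls} odd
        | filter-accept (λ (l : List L) → odd? (length l)) {l} {ls} odd
        | sign
  = trans (lemma (+ evens ls) (+ odds ls)) (cong (_+_ -1ℤ) (total-signed ls))
  where
  lemma : ∀ x y → x - (1ℤ + y) ≡ -1ℤ + (x - y)
  lemma = solve-∀

∈-parts : ∀ {n s} → 0 < s → s ≤ n → s ∈ parts n
∈-parts {s = suc i} _ i<n = ∈-map⁺ suc (∈-upTo⁺ i<n)

parts-unique : ∀ n → Unique (parts n)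
parts-unique n = Unique.map⁺ ℕₚ.suc-injective (Unique.upTo⁺ n)

module Pod where

  -- The tie rule says that equal parts are even, hence a letter is repeatable exactly when it is
  -- even.
  open Words {ℕ} id (λ s _ → Even s) (λ s _ → even? s) 1ℤ public

  plainPart : ℕ → List ℕ
  plainPart k = k ∷ []

  plainPart-size : ∀ k {a} → a ∈ plainPart k → a ≡ k
  plainPart-size k (here eq) = eq

  plainPart-unique : ∀ k → Unique (plainPart k)
  plainPart-unique k = [] ∷ []

  open Blocks plainPart plainPart-size plainPart-unique public

  -- Turns the condition on the filtered list into one on pairs of parts, which merges with the
  -- ordering into the single relation `R`.
  pairwise⁺ : ∀ {ps} → Unique (filter odd? ps) → AllPairs (λ s t → s ≡ t → Even s) ps
  pairwise⁺ {[]}     _  = []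
  pairwise⁺ {p ∷ ps} !f with even? p
  ... | yes even = All.universal (λ _ _ → even) ps ∷
    pairwise⁺ (subst Unique (filter-reject odd? (λ odd → odd even)) !f)
  ... | no odd with p∉ ∷ !f′ ← subst Unique (filter-accept odd? odd) !f =
    All.tabulate (λ t∈ → λ { refl → contradiction refl (All.lookup p∉ (∈-filter⁺ odd? t∈ odd)) })
      ∷ pairwise⁺ !f′

  pairwise⁻ : ∀ {ps} → AllPairs (λ s t → s ≡ t → Even s) ps → Unique (filter odd? ps)
  pairwise⁻ {ps} pairs = distinct (AllPairs.filter⁺ odd? pairs) (All.all-filter odd? ps)
    where
    distinct : ∀ {qs} → AllPairs (λ s t → s ≡ t → Even s) qs → All Odd qs → Unique qs
    distinct []            []           = []
    distinct (evens ∷ prs) (odd ∷ odds) = All.map (odd ∘_) evens ∷ distinct prs odds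

  isPod⇔ : ∀ {n ps} → IsPodPartition n ps ⇔ (All Valid ps × Word n ps)
  isPod⇔ {ps = ps} = mk⇔
    (λ ((positive , sorted , sum≡) , !odds) →
      All.map (λ 0<p → 0<p , here refl) positive ,
      AllPairs.zip (Linked.Linked⇒AllPairs (flip ℕₚ.≤-trans) sorted , pairwise⁺ !odds) ,
      trans (cong sum (map-id ps)) sum≡)
    (λ (valid , pairs , sum≡) →
      (All.map proj₁ valid , Linked.AllPairs⇒Linked (AllPairs.map proj₁ pairs) ,
        trans (cong sum (sym (map-id ps))) sum≡) ,
      pairwise⁻ (AllPairs.map proj₂ pairs))

  pod≡ : ∀ {n m} → n ≤ m → + pod n ≡ genFun m n
  pod≡ {n} n≤m = trans (total-1 (filter (isPodPartition? n) (listsUpTo (parts n) n)))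
    (total-genFun (isPodPartition? n) n≤m (parts-unique n)
      (λ (0<s , _) s≤n → ∈-parts 0<s s≤n) isPod⇔)

  genFun-even : ∀ m → Even (suc m) → factor -1ℤ (suc m) (genFun (suc m)) ≗ genFun m
  genFun-even m even = count-repeatable (alphabet-positive (suc m)) (alphabet-unique (suc m))
    (alphabet-dominated m refl) (ℕₚ.≤-refl , λ _ → even)

  genFun-odd : ∀ m → Odd (suc m) → genFun (suc m) ≗ factor 1ℤ (suc m) (genFun m)
  genFun-odd m odd = count-distinct (alphabet-positive (suc m)) (alphabet-unique (suc m))
    (alphabet-dominated m refl) (λ (_ , even) → odd (even refl))

module Over where

  open Words {ℕ × Bool} proj₁ (λ _ (_ , o) → o ≡ false) (λ _ (_ , o) → o Bool.≟ false) 1ℤ public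

  -- The overlined letter comes first: only plain letters may follow an equal part, so it dominates
  -- the plain one and is not repeatable.
  flags : ℕ → List (ℕ × Bool)
  flags k = (k , true) ∷ (k , false) ∷ []

  flags-size : ∀ k {a} → a ∈ flags k → proj₁ a ≡ k
  flags-size k (here refl)         = refl
  flags-size k (there (here refl)) = refl

  flags-unique : ∀ k → Unique (flags k)
  flags-unique k = ((λ ()) ∷ []) ∷ [] ∷ []

  ∈-flags : ∀ k o → (k , o) ∈ flags k
  ∈-flags k true  = here refl
  ∈-flags k false = there (here refl)

  open Blocks flags flags-size flags-unique public

  isOver⇔ : ∀ {n ps} → IsOverpartition n ps ⇔ (All Valid ps × Word n ps)
  isOver⇔ = mk⇔
    (λ ((positive , sorted , sum≡) , firsts) →
      All.map (λ 0<p → 0<p , ∈-flags _ _) (All.map⁻ positive) ,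
      AllPairs.zip (AllPairs.map⁻ (Linked.Linked⇒AllPairs (flip ℕₚ.≤-trans) sorted) , firsts) ,
      sum≡)
    (λ (valid , pairs , sum≡) →
      (All.map⁺ (All.map proj₁ valid) ,
        Linked.AllPairs⇒Linked (AllPairs.map⁺ (AllPairs.map proj₁ pairs)) , sum≡) ,
      AllPairs.map proj₂ pairs)

  p̄≡ : ∀ {n m} → n ≤ m → + p̄ (+ n) ≡ genFun m n
  p̄≡ {n} n≤m = trans (total-1 (overpartitions n)) (total-genFun (isOverpartition? n) n≤m
    (Unique.cartesianProduct⁺ (parts-unique n) (((λ ()) ∷ []) ∷ [] ∷ []))
    (λ {a} (0<s , _) s≤n → ∈-cartesianProduct⁺ (∈-parts 0<s s≤n) (flag (proj₂ a)))
    isOver⇔)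
    where
    flag : ∀ o → o ∈ false ∷ true ∷ []
    flag false = here refl
    flag true  = there (here refl)

  -- The plain letter is repeatable and accounts for 1 / (1 - qᵏ), the overlined one is not and
  -- accounts for 1 + qᵏ.
  genFun-suc : ∀ m → factor -1ℤ (suc m) (genFun (suc m)) ≗ factor 1ℤ (suc m) (genFun m)
  genFun-suc m n = begin
    factor -1ℤ k (genFun k) n          ≡⟨ factor-cong -1ℤ k overlined n ⟩
    factor -1ℤ k (factor 1ℤ k G) n     ≡⟨ factor-comm -1ℤ k 1ℤ k G n ⟩
    factor 1ℤ k (factor -1ℤ k G) n     ≡⟨ factor-cong 1ℤ k plain n ⟩
    factor 1ℤ k (genFun m) n           ∎
    where
    open ≡-Reasoning
    k : ℕ
    k = suc m
    true≢false : ¬ true ≡ false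
    true≢false ()
    G = count ((k , false) ∷ alphabet m)
    positive : Positive ((k , false) ∷ alphabet m)
    positive a∈ = alphabet-positive k (there a∈)
    plain : factor -1ℤ k G ≗ genFun m
    plain = count-repeatable positive (AllPairs.tail (alphabet-unique k))
      (alphabet-dominated m refl) (ℕₚ.≤-refl , λ _ → refl)
    dominates : Dominates (k , true) ((k , false) ∷ alphabet m)
    dominates (here refl) = (ℕₚ.≤-refl , λ _ → refl) , λ (_ , o) → true≢false (o refl)
    dominates (there b∈)  = alphabet-dominated m refl b∈
    overlined : genFun k ≗ factor 1ℤ k G
    overlined = count-distinct (alphabet-positive k) (alphabet-unique k) dominates
      (λ (_ , o) → true≢false (o refl))

module TwoColoured where

  colours : ℕ → List (ℕ × Fin 2)
  colours k with even? k
  ... | yes _ = (k , zero) ∷ (k , suc zero) ∷ []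
  ... | no  _ = (k , zero) ∷ []

  colours-size : ∀ k {a} → a ∈ colours k → proj₁ a ≡ k
  colours-size k a∈ with even? k
  colours-size k (here refl)         | yes _ = refl
  colours-size k (there (here refl)) | yes _ = refl
  colours-size k (here refl)         | no _  = refl

  colours-unique : ∀ k → Unique (colours k)
  colours-unique k with even? k
  ... | yes _ = ((λ ()) ∷ []) ∷ [] ∷ []
  ... | no _  = [] ∷ []

  ∈-colours⁺ : ∀ s c → (Odd s → c ≡ zero) → (s , c) ∈ colours s
  ∈-colours⁺ s c odd⇒0 with even? s
  ∈-colours⁺ s zero       odd⇒0 | yes _  = here refl
  ∈-colours⁺ s (suc zero) odd⇒0 | yes _  = there (here refl)
  ∈-colours⁺ s c          odd⇒0 | no odd = here (cong (s ,_) (odd⇒0 odd))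

  ∈-colours⁻ : ∀ s c → (s , c) ∈ colours s → Odd s → c ≡ zero
  ∈-colours⁻ s c a∈ odd with even? s
  ∈-colours⁻ s c a∈          odd | yes even = contradiction even odd
  ∈-colours⁻ s c (here refl) odd | no _     = refl

  open Words {ℕ × Fin 2} proj₁
    (λ (_ , c) (_ , d) → c Fin.≤ d) (λ (_ , c) (_ , d) → c Fin.≤? d) -1ℤ public
  open Blocks colours colours-size colours-unique public

  isTwoColoured⇔ : ∀ {n ps} → IsTwoColouredPartition n ps ⇔ (All Valid ps × Word n ps)
  isTwoColoured⇔ = mk⇔
    (λ ((positive , sorted , sum≡) , oddColours , ordered) →
      All.zipWith (λ (0<p , odd⇒0) → 0<p , ∈-colours⁺ _ _ odd⇒0) (All.map⁻ positive , oddColours) ,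
      -- The colour condition on neighbours is not transitive by itself, as a different size may
      -- intervene; joined with the ordering it becomes `R`, which is.
      Linked.Linked⇒AllPairs (R-trans ℕₚ.≤-trans) (Linked.zip (Linked.map⁻ sorted , ordered)) ,
      sum≡)
    (λ (valid , pairs , sum≡) →
      let linked = Linked.AllPairs⇒Linked pairs in
      (All.map⁺ (All.map proj₁ valid) , Linked.map⁺ (Linked.map proj₁ linked) , sum≡) ,
      All.map (λ (_ , a∈) → ∈-colours⁻ _ _ a∈) valid ,
      Linked.map proj₂ linked)


  A≡ : ∀ {n m} → n ≤ m → A n ≡ genFun m n
  A≡ {n} n≤m = trans (total-signed (twoColouredPartitions n))
    (total-genFun (isTwoColouredPartition? n) n≤m
      (Unique.cartesianProduct⁺ (parts-unique n) (Unique.allFin⁺ 2))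
      (λ (0<s , _) s≤n → ∈-cartesianProduct⁺ (∈-parts 0<s s≤n) (∈-allFin _)) isTwoColoured⇔)

  genFun-even : ∀ m → Even (suc m) →
    factor 1ℤ (suc m) (factor 1ℤ (suc m) (genFun (suc m))) ≗ genFun m
  -- Both facts mention the block of size `suc m`; they are bound before the parity split so that it
  -- evaluates the block in their types too.
  genFun-even m even n with alphabet-positive (suc m) | alphabet-unique (suc m)
  ... | positive | unique with even? (suc m)
  ... | no odd = contradiction even odd
  ... | yes _  = trans (factor-cong 1ℤ (suc m) first n) (second n)
    where
    dominates : Dominates (suc m , zero) ((suc m , suc zero) ∷ alphabet m)
    dominates (here refl) = (ℕₚ.≤-refl , λ _ → z≤n) , λ (_ , c) → contradiction (c refl) (λ ())
    dominates (there b∈)  = alphabet-dominated m refl b∈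
    first : factor 1ℤ (suc m) (count ((suc m , zero) ∷ (suc m , suc zero) ∷ alphabet m))
      ≗ count ((suc m , suc zero) ∷ alphabet m)
    first = count-repeatable positive unique dominates (ℕₚ.≤-refl , λ _ → z≤n)
    second : factor 1ℤ (suc m) (count ((suc m , suc zero) ∷ alphabet m)) ≗ genFun m
    second = count-repeatable (λ a∈ → positive (there a∈)) (AllPairs.tail unique)
      (alphabet-dominated m refl) (ℕₚ.≤-refl , λ _ → ℕₚ.≤-refl)

  genFun-odd : ∀ m → Odd (suc m) → factor 1ℤ (suc m) (genFun (suc m)) ≗ genFun m
  genFun-odd m odd n with alphabet-positive (suc m) | alphabet-unique (suc m)
  ... | positive | unique with even? (suc m)
  ... | yes even = contradiction even odd
  ... | no _     = count-repeatable positive unique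
    (alphabet-dominated m refl) (ℕₚ.≤-refl , λ _ → z≤n) n

-- The product identity

downTo1 : ℕ → List ℕ
downTo1 zero    = []
downTo1 (suc m) = suc m ∷ downTo1 m

double : ℕ → ℕ
double k = k ℕ.+ k

-- The exponent of the part k in H: the numerator 1 + qᵏ of p̄ cancels one denominator of A, and for
-- even k the remaining one turns 1 - qᵏ into 1 - q²ᵏ.
doubleEven : ℕ → ℕ
doubleEven k with even? k
... | yes _ = double k
... | no  _ = k

doubleEven-even : ∀ {k} → Even k → doubleEven k ≡ double k
doubleEven-even {k} even with even? k
... | yes _ = refl
... | no odd = contradiction even odd

doubleEven-odd : ∀ {k} → Odd k → doubleEven k ≡ k
doubleEven-odd {k} odd with even? k
... | yes even = contradiction even odd
... | no _ = refl

doubleEven-positive : ∀ {k} → 0 < k → 0 < doubleEven k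
doubleEven-positive {k} 0<k with even? k
... | yes _ = ℕₚ.<-≤-trans 0<k (ℕₚ.m≤m+n k k)
... | no _  = 0<k

evensTo doublesTo evensDoubledTo : ℕ → List ℕ
evensDoubledTo m = map doubleEven (downTo1 m)
evensTo        m = filter even? (downTo1 m)
doublesTo      m = map double (downTo1 m)

downTo1-positive : ∀ m → All (0 <_) (downTo1 m)
downTo1-positive zero    = []
downTo1-positive (suc m) = s≤s z≤n ∷ downTo1-positive m

-- Exhibits ∏ (1 - q²ᵏ) over k ≤ m as a longer run of the product over even exponents, so that
-- comparing the two is mere truncation.
doublesTo≡evensTo : ∀ m → doublesTo m ≡ evensTo (double m)
doublesTo≡evensTo zero    = refl
doublesTo≡evensTo (suc m) = begin
  double (suc m) ∷ doublesTo m
    ≡⟨ cong₂ _∷_ (ℕₚ.+-suc (suc m) m) (doublesTo≡evensTo m) ⟩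
  suc (suc (double m)) ∷ evensTo (double m)
    ≡⟨ cong (suc (suc (double m)) ∷_) (filter-reject even? (even⇒odd-suc (even-double m))) ⟨
  suc (suc (double m)) ∷ evensTo (suc (double m))
    ≡⟨ filter-accept even? (∣m∣n⇒∣m+n ∣-refl (even-double m)) ⟨
  evensTo (suc (suc (double m)))
    ≡⟨ cong evensTo (ℕₚ.+-suc (suc m) m) ⟨
  evensTo (double (suc m)) ∎
  where open ≡-Reasoning

-- The additional factors 1 - qᵏ have k > m and leave the coefficients up to qᵐ untouched.
prod-evensTo-truncated : ∀ m d f n → n ≤ m → prod (evensTo (d ℕ.+ m)) f n ≡ prod (evensTo m) f n
prod-evensTo-truncated m zero    f n n≤m = refl
prod-evensTo-truncated m (suc d) f n n≤m with even? (suc (d ℕ.+ m))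
... | no odd = trans (cong (λ ks → prod ks f n) (filter-reject even? odd))
  (prod-evensTo-truncated m d f n n≤m)
... | yes even = begin
  prod (evensTo (suc (d ℕ.+ m))) f n
    ≡⟨ cong (λ ks → prod ks f n) (filter-accept even? even) ⟩
  prod (evensTo (d ℕ.+ m)) (factor -1ℤ (suc (d ℕ.+ m)) f) n
    ≡⟨ prod-cong-≤ (evensTo (d ℕ.+ m))
         (λ i i≤m → factor-> -1ℤ f (s≤s (ℕₚ.≤-trans i≤m (ℕₚ.m≤n+m m d)))) n n≤m ⟩
  prod (evensTo (d ℕ.+ m)) f n
    ≡⟨ prod-evensTo-truncated m d f n n≤m ⟩
  prod (evensTo m) f n ∎
  where open ≡-Reasoning

product : ℕ → Series
product m = conv (TwoColoured.genFun m) (Over.genFun m)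

product-suc : ∀ m → factor -1ℤ (doubleEven (suc m)) (product (suc m)) ≗ product m
-- The extra factor 1 + qᵏ matches the one that p̄ leaves on the right. For even k, (1 + qᵏ)(1 -
-- q²ᵏ) = (1 - qᵏ)(1 + qᵏ)², where the square clears the two colours and 1 - qᵏ goes to p̄; for odd
-- k a single 1 + qᵏ clears A.
product-suc m = factor-cancel 1ℤ _ _ {suc m} (s≤s z≤n) (by-parity (even? (suc m)))
  where
  open ≡-Reasoning
  k = ℕ.suc m
  A′ = TwoColoured.genFun k
  P′ = Over.genFun k
  overFactor : ∀ f → factor -1ℤ k (conv f P′) ≗ factor 1ℤ k (conv f (Over.genFun m))
  overFactor f n = begin
    factor -1ℤ k (conv f P′) n            ≡⟨ conv-factorʳ -1ℤ k f P′ n ⟨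
    conv f (factor -1ℤ k P′) n            ≡⟨ conv-cong (λ _ → refl) (Over.genFun-suc m) n ⟩
    conv f (factor 1ℤ k (Over.genFun m)) n  ≡⟨ conv-factorʳ 1ℤ k f (Over.genFun m) n ⟩
    factor 1ℤ k (conv f (Over.genFun m)) n ∎
  by-parity : Dec (Even k) →
    factor 1ℤ k (factor -1ℤ (doubleEven k) (product k)) ≗ factor 1ℤ k (product m)
  by-parity (yes even) n = begin
    factor 1ℤ k (factor -1ℤ (doubleEven k) (product k)) n
      ≡⟨ cong (λ i → factor 1ℤ k (factor -1ℤ i (product k)) n) (doubleEven-even even) ⟩
    factor 1ℤ k (factor -1ℤ (double k) (product k)) n
      ≡⟨ factor-cong 1ℤ k (factor-difference-of-squares k (product k)) n ⟨
    factor 1ℤ k (factor -1ℤ k (factor 1ℤ k (product k))) n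
      ≡⟨ factor-comm 1ℤ k -1ℤ k (factor 1ℤ k (product k)) n ⟩
    factor -1ℤ k (factor 1ℤ k (factor 1ℤ k (product k))) n
      ≡⟨ factor-cong -1ℤ k (factor-cong 1ℤ k (conv-factorˡ 1ℤ k A′ P′)) n ⟨
    factor -1ℤ k (factor 1ℤ k (conv (factor 1ℤ k A′) P′)) n
      ≡⟨ factor-cong -1ℤ k (conv-factorˡ 1ℤ k (factor 1ℤ k A′) P′) n ⟨
    factor -1ℤ k (conv (factor 1ℤ k (factor 1ℤ k A′)) P′) n
      ≡⟨ factor-cong -1ℤ k (conv-cong (TwoColoured.genFun-even m even) (λ _ → refl)) n ⟩
    factor -1ℤ k (conv (TwoColoured.genFun m) P′) n
      ≡⟨ overFactor (TwoColoured.genFun m) n ⟩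
    factor 1ℤ k (product m) n ∎
  by-parity (no odd) n = begin
    factor 1ℤ k (factor -1ℤ (doubleEven k) (product k)) n
      ≡⟨ cong (λ i → factor 1ℤ k (factor -1ℤ i (product k)) n) (doubleEven-odd odd) ⟩
    factor 1ℤ k (factor -1ℤ k (product k)) n
      ≡⟨ factor-comm 1ℤ k -1ℤ k (product k) n ⟩
    factor -1ℤ k (factor 1ℤ k (product k)) n
      ≡⟨ factor-cong -1ℤ k (conv-factorˡ 1ℤ k A′ P′) n ⟨
    factor -1ℤ k (conv (factor 1ℤ k A′) P′) n
      ≡⟨ factor-cong -1ℤ k (conv-cong (TwoColoured.genFun-odd m odd) (λ _ → refl)) n ⟩
    factor -1ℤ k (conv (TwoColoured.genFun m) P′) n
      ≡⟨ overFactor (TwoColoured.genFun m) n ⟩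
    factor 1ℤ k (product m) n ∎

prod-evensDoubledTo-product : ∀ m → prod (evensDoubledTo m) (product m) ≗ δ
prod-evensDoubledTo-product zero    n =
  trans (conv-cong TwoColoured.count-[] Over.count-[] n) (conv-identityˡ δ n)
prod-evensDoubledTo-product (suc m) n =
  trans (prod-cong (evensDoubledTo m) (product-suc m) n) (prod-evensDoubledTo-product m n)

-- Each part k leaves 1 - q²ᵏ. For even k this is the factor of H, while 1 - qᵏ from `evensTo`
-- clears the denominator of pod; for odd k it is (1 - qᵏ)(1 + qᵏ), from H and from pod.
prod-evensDoubledTo-pod : ∀ m →
  prod (evensDoubledTo m) (prod (evensTo m) (Pod.genFun m)) ≗ prod (doublesTo m) δ
prod-evensDoubledTo-pod zero    n = Pod.count-[] n
prod-evensDoubledTo-pod (suc m) n = begin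
  prod (evensDoubledTo (suc m)) (prod (evensTo (suc m)) Q′) n
    ≡⟨ prod-cong (evensDoubledTo m) (by-parity (even? k)) n ⟩
  prod (evensDoubledTo m) (factor -1ℤ (double k) (prod (evensTo m) Q)) n
    ≡⟨ prod-factor (evensDoubledTo m) -1ℤ (double k) (prod (evensTo m) Q) n ⟩
  factor -1ℤ (double k) (prod (evensDoubledTo m) (prod (evensTo m) Q)) n
    ≡⟨ factor-cong -1ℤ (double k) (prod-evensDoubledTo-pod m) n ⟩
  factor -1ℤ (double k) (prod (doublesTo m) δ) n
    ≡⟨ prod-factor (doublesTo m) -1ℤ (double k) δ n ⟨
  prod (doublesTo (suc m)) δ n ∎
  where
  open ≡-Reasoning
  k = ℕ.suc m
  Q  = Pod.genFun m
  Q′ = Pod.genFun k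
  by-parity : Dec (Even k) →
    factor -1ℤ (doubleEven k) (prod (evensTo k) Q′) ≗ factor -1ℤ (double k) (prod (evensTo m) Q)
  by-parity (yes even) i = begin
    factor -1ℤ (doubleEven k) (prod (evensTo k) Q′) i
      ≡⟨ cong₂ (λ j ks → factor -1ℤ j (prod ks Q′) i) (doubleEven-even even) (filter-accept even? even) ⟩
    factor -1ℤ (double k) (prod (evensTo m) (factor -1ℤ k Q′)) i
      ≡⟨ factor-cong -1ℤ (double k) (prod-cong (evensTo m) (Pod.genFun-even m even)) i ⟩
    factor -1ℤ (double k) (prod (evensTo m) Q) i ∎
  by-parity (no odd) i = begin
    factor -1ℤ (doubleEven k) (prod (evensTo k) Q′) i
      ≡⟨ cong₂ (λ j ks → factor -1ℤ j (prod ks Q′) i) (doubleEven-odd odd) (filter-reject even? odd) ⟩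
    factor -1ℤ k (prod (evensTo m) Q′) i
      ≡⟨ factor-cong -1ℤ k (prod-cong (evensTo m) (Pod.genFun-odd m odd)) i ⟩
    factor -1ℤ k (prod (evensTo m) (factor 1ℤ k Q)) i
      ≡⟨ factor-cong -1ℤ k (prod-factor (evensTo m) 1ℤ k Q) i ⟩
    factor -1ℤ k (factor 1ℤ k (prod (evensTo m) Q)) i
      ≡⟨ factor-difference-of-squares k (prod (evensTo m) Q) i ⟩
    factor -1ℤ (double k) (prod (evensTo m) Q) i ∎

product≡pod : ∀ m n → n ≤ m → product m n ≡ Pod.genFun m n
product≡pod m = prod-cancel-≤ (product m) Q
  (All.map⁺ (All.map doubleEven-positive (downTo1-positive m)))
  (prod-cancel-≤ _ _ (All.filter⁺ even? (downTo1-positive m)) truncated)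
  where
  open ≡-Reasoning
  Q = Pod.genFun m
  truncated : ∀ n → n ≤ m →
    prod (evensTo m) (prod (evensDoubledTo m) (product m)) n
      ≡ prod (evensTo m) (prod (evensDoubledTo m) Q) n
  truncated n n≤m = begin
    prod (evensTo m) (prod (evensDoubledTo m) (product m)) n
      ≡⟨ prod-cong (evensTo m) (prod-evensDoubledTo-product m) n ⟩
    prod (evensTo m) δ n          ≡⟨ prod-evensTo-truncated m m δ n n≤m ⟨
    prod (evensTo (double m)) δ n ≡⟨ cong (λ ks → prod ks δ n) (doublesTo≡evensTo m) ⟨
    prod (doublesTo m) δ n        ≡⟨ prod-evensDoubledTo-pod m n ⟨
    prod (evensDoubledTo m) (prod (evensTo m) Q) n
      ≡⟨ prod-comm (evensDoubledTo m) (evensTo m) Q n ⟩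
    prod (evensTo m) (prod (evensDoubledTo m) Q) n ∎

theorem4p6 : ∀ (n : ℕ) → (λ j → A j * + p̄ (+ n - + j)) SumsTo (+ pod n)
theorem4p6 n = subst ((λ j → A j * + p̄ (+ n - + j)) SumsTo_) coefficient
  (convolution-sumsTo A (+_ ∘ p̄) (λ _ → refl) n)
  where
  coefficient : conv A (λ m → + p̄ (+ m)) n ≡ + pod n
  coefficient = begin
    conv A (λ m → + p̄ (+ m)) n
      -- The convolution at n reads no coefficient beyond n, so the cut-off m = n serves for both
      -- series at once.
      ≡⟨ conv-cong-≤ n (λ _ m≤n → TwoColoured.A≡ m≤n) (λ _ m≤n → Over.p̄≡ m≤n) ⟩
    product n n
      ≡⟨ product≡pod n n ℕₚ.≤-refl ⟩
    Pod.genFun n n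
      ≡⟨ Pod.pod≡ {n} ℕₚ.≤-refl ⟨
    + pod n ∎
    where open ≡-Reasoning
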